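{- Let $m<n$ be positive integers and let $Q$ be an $m$-vertex directed graph with adjacency matrix $A_Q=[q_{ij}]_{m\times m}$. Then $Q$ is a quotient graph of some $n$-vertex symmetric directed graph $G$ by a balanced equivalence relation on the set of vertices of $G$ if and only if there are positive integers $k_1,\ldots,k_m$ with $k_1+\cdots+k_m=n$ such that $$k_i q_{ij}=k_j q_{ji}\qquad\text{for all } i,j\in\{1,\ldots,m\}.$$
   Context: Directed graphs are finite and may have loops and multiple edges. The adjacency matrix of a directed graph with vertices $1,\ldots,n$ is the $n\times n$ matrix of non-negative integers whose $(i,j)$ entry is the number of directed edges from vertex $j$ to vertex $i$. A directed graph is symmetric (bidirected) if its adjacency matrix is symmetric. An equivalence relation $\bowtie$ on the vertex set of a directed graph $G$ is balanced if, for any two vertices $u,v$ in the same $\bowtie$-class and any $\bowtie$-class $C$, the number of directed edges from vertices of $C$ to $u$ equals the number of directed edges from vertices of $C$ to $v$. For a balanced $\bowtie$ with classes $I_1,\ldots,I_m$, the quotient graph $G/\bowtie$ has one vertex for each class, and its edges are the projections of the edges of $G$: its adjacency matrix $[q_{ij}]_{m\times m}$ is given by letting $q_{ij}$ be the number of directed edges of $G$ from vertices of $I_j$ to any given vertex of $I_i$ (well defined since $\bowtie$ is balanced). $Q$ is a quotient graph of $G$ by $\bowtie$ if $Q=G/\bowtie$, under some labelling of the classes by the vertices of $Q$. -}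

module Defs where

open import Data.Fin.Base using (Fin)
open import Data.Fin.Properties using (_≟_)
open import Data.List.Base using (allFin; filter; length)
open import Data.Nat.Base using (ℕ)
open import Data.Product.Base using (proj₁)
open import Function.Bundles using (Bijection)
open import Level using (0ℓ)
open import Relation.Binary.Bundles using (Setoid)
open import Relation.Binary.Core using (Rel)
open import Relation.Binary.PropositionalEquality using (_≡_; setoid)
open import Relation.Binary.Structures using (IsDecEquivalence)
open import Relation.Nullary.Decidable using (_×-dec_)
open import Relation.Unary using (Pred; Decidable)

-- Loops and multiple edges are allowed: source and target are arbitrary maps.
record Digraph (n : ℕ) : Set where
  field
    edgeCount : ℕ
    source    : Fin edgeCount → Fin n
    target    : Fin edgeCount → Fin n

open Digraph public

-- The number of edges to u from vertices satisfying P.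
edgesInto : ∀ {n} (G : Digraph n) {P : Pred (Fin n) 0ℓ} →
            Decidable P → Fin n → ℕ
edgesInto G P? u =
  length (filter (λ e → P? (source G e) ×-dec (target G e ≟ u))
                 (allFin (edgeCount G)))

-- Columns are sources and rows are targets: the (i , j) entry counts the
-- edges from j to i.
adjacency : ∀ {n} → Digraph n → Fin n → Fin n → ℕ
adjacency G i j = edgesInto G (_≟ j) i

Symmetric : ∀ {n} → Digraph n → Set
Symmetric G = ∀ i j → adjacency G i j ≡ adjacency G j i

module _ {n : ℕ} {_⋈_ : Rel (Fin n) 0ℓ} (isDecEq : IsDecEquivalence _⋈_) where

  private module ⋈ = IsDecEquivalence isDecEq

  -- A class C is given by any of its members w, as C = { x ∣ x ⋈ w }.
  Balanced : Digraph n → Set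
  Balanced G = ∀ {u v} → u ⋈ v → ∀ w →
    edgesInto G (⋈._≟ w) u ≡ edgesInto G (⋈._≟ w) v

  -- The setoid whose elements, up to its equality, are the ⋈-classes.
  classes : Setoid 0ℓ 0ℓ
  classes = record { isEquivalence = ⋈.isEquivalence }

  -- A numbering I₁, …, Iₘ of the classes.  A vertex v lies in the class
  -- numbered Bijection.to L v.
  Labelling : ℕ → Set
  Labelling m = Bijection classes (setoid (Fin m))

  -- The adjacency matrix of G / ⋈.  Row i is read off at the representative
  -- of Iᵢ chosen by surjectivity; for balanced ⋈ all choices agree.
  quotientMatrix : ∀ {m} → Digraph n → Labelling m → Fin m → Fin m → ℕ
  quotientMatrix G L i j =
    edgesInto G (λ v → Bijection.to L v ≟ j) (proj₁ (Bijection.surjective L i))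

-- Digraphs on the same vertices are identified when their adjacency matrices
-- agree, so Q = G / ⋈ is an equality of matrices.  Decidability of ⋈ costs no
-- generality: a labelling of the classes by Fin m already implies it.
record _IsQuotientOf_ {m n : ℕ} (Q : Digraph m) (G : Digraph n) : Set₁ where
  field
    _⋈_        : Rel (Fin n) 0ℓ
    isDecEq    : IsDecEquivalence _⋈_
    balanced   : Balanced isDecEq G
    labelling  : Labelling isDecEq m
    adjacency≡ : ∀ i j →
      adjacency Q i j ≡ quotientMatrix isDecEq G labelling i j

{-# OPTIONS --safe #-}

-- Both sides of k_i q_ij = k_j q_ji count the edges of G between the classes
-- I_i and I_j, where k_i is the size of I_i.  Conversely, let I_i have k_i
-- vertices and place E = k_i q_ij = k_j q_ji edges between I_i and I_j, the
-- e-th one joining the vertices e mod k_i of I_i and e mod k_j of I_j.  As k_i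
-- divides E, each vertex of I_i is met E / k_i = q_ij times; as the recipe
-- depends symmetrically on i and j, the graph is symmetric.
module Submission where

open import Defs
open import Algebra.Properties.CommutativeMonoid.Sum using (sum)
open import Data.Bool.Base using (Bool; true; false; if_then_else_)
open import Data.Fin.Base using (Fin; zero; suc; toℕ; _↑ˡ_; _↑ʳ_; splitAt)
open import Data.Fin.Properties
  using (_≟_; splitAt-↑ˡ; splitAt-↑ʳ; toℕ-↑ˡ; toℕ-↑ʳ; toℕ-fromℕ<; toℕ-injective; toℕ<n)
open import Data.List.Base using (filter; length; tabulate)
open import Data.Nat.Base
  using (ℕ; zero; suc; _+_; _*_; _<_; _≤_; NonZero; >-nonZero)
open import Data.Nat.DivMod using (_mod_; _%_; m%n<n; m<n⇒m%n≡m; [m+n]%n≡m%n)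
open import Data.Nat.Properties
  using (+-0-commutativeMonoid; +-*-semiring; +-assoc; +-comm; +-identityʳ;
         *-assoc; *-comm; *-commutativeSemigroup; *-identityʳ; m≤m+n; m≤n+m; ≤-reflexive; ≤-trans)
open import Algebra.Properties.CommutativeSemigroup *-commutativeSemigroup
  using () renaming (x∙yz≈y∙xz to x*[y*z]≡y*[x*z])
open import Algebra.Properties.Semiring.Sum +-*-semiring
  using (sum-syntax; sum-cong-≗; sum-replicate-zero; ∑-comm; *-distribˡ-sum; *-distribʳ-sum)
open import Data.Product.Base using (Σ-syntax; _×_; _,_; proj₁; proj₂; map)
open import Data.Sum.Base using ([_,_]′)
open import Function.Base using (id; _∘_)
open import Function.Bundles using (_⇔_; mk⇔; Bijection)
open import Level using (0ℓ)
open import Relation.Binary.Construct.On as On using ()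
open import Relation.Binary.PropositionalEquality
  using (_≡_; refl; sym; trans; cong; cong₂; module ≡-Reasoning)
open import Relation.Binary.PropositionalEquality.Properties using (isDecEquivalence)
open import Relation.Binary.Structures using (IsDecEquivalence)
open import Relation.Nullary.Decidable using (Dec; yes; no; does; does-⇔; dec-true; _×-dec_)
open import Relation.Unary using (Pred; Decidable)
open ≡-Reasoning

-- Finite sums

∑-1 : ∀ n → ∑[ i < n ] 1 ≡ n
∑-1 zero    = refl
∑-1 (suc n) = cong suc (∑-1 n)

term≤∑ : ∀ {n} (f : Fin n → ℕ) i → f i ≤ ∑[ j < n ] f j
term≤∑ f zero    = m≤m+n _ _
term≤∑ f (suc i) = ≤-trans (term≤∑ (f ∘ suc) i) (m≤n+m _ _)

∑-↑ : ∀ m {n} (f : Fin (m + n) → ℕ) →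
      ∑[ x < m + n ] f x ≡ ∑[ x < m ] f (x ↑ˡ n) + ∑[ x < n ] f (m ↑ʳ x)
∑-↑ zero    f = refl
∑-↑ (suc m) f =
  trans (cong (f zero +_) (∑-↑ m (f ∘ suc))) (sym (+-assoc (f zero) _ _))

-- The summands are functions on `ℕ`, so the two bounds need only be propositionally equal and no
-- index is transported between `Fin m` and `Fin n`.
∑-toℕ-cong : ∀ {m n} {f g : ℕ → ℕ} → m ≡ n → (∀ x → f x ≡ g x) →
             ∑[ e < m ] f (toℕ e) ≡ ∑[ e < n ] g (toℕ e)
∑-toℕ-cong {m} refl f≗g = sum-cong-≗ {m} (f≗g ∘ toℕ)

-- Indicators of decidable propositions

indicator : Bool → ℕ
indicator b = if b then 1 else 0

𝟙 : ∀ {P : Set} → Dec P → ℕ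
𝟙 P? = indicator (does P?)

𝟙-true : ∀ {P : Set} (P? : Dec P) → P → 𝟙 P? ≡ 1
𝟙-true P? p = cong indicator (dec-true P? p)

𝟙-⇔ : ∀ {P Q : Set} (P? : Dec P) (Q? : Dec Q) → (P → Q) → (Q → P) → 𝟙 P? ≡ 𝟙 Q?
𝟙-⇔ P? Q? f g = cong indicator (does-⇔ (mk⇔ f g) P? Q?)

𝟙-× : ∀ {P Q : Set} (P? : Dec P) (Q? : Dec Q) → 𝟙 (P? ×-dec Q?) ≡ 𝟙 P? * 𝟙 Q?
𝟙-× P? Q? with does P?
... | false = refl
... | true  = sym (+-identityʳ _)

𝟙-*-cong : ∀ {P : Set} (P? : Dec P) {a b} → (P → a ≡ b) → 𝟙 P? * a ≡ 𝟙 P? * b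
𝟙-*-cong (yes p) eq = cong (1 *_) (eq p)
𝟙-*-cong (no _)  eq = refl

-- The sifting property of the Kronecker delta. With the fixed index on the left of `≟`, the
-- recursion on `i` goes through by computation; `𝟙-≟-sym` brings other indicators into this
-- orientation.
∑-𝟙-≟ : ∀ {n} (i : Fin n) (f : Fin n → ℕ) → ∑[ j < n ] (𝟙 (i ≟ j) * f j) ≡ f i
∑-𝟙-≟ {suc n} zero f = begin
  f zero + 0 + ∑[ j < n ] 0  ≡⟨ cong (f zero + 0 +_) (sum-replicate-zero n) ⟩
  f zero + 0 + 0             ≡⟨ +-identityʳ _ ⟩
  f zero + 0                 ≡⟨ +-identityʳ _ ⟩
  f zero                     ∎
∑-𝟙-≟ {suc n} (suc i) f = ∑-𝟙-≟ i (f ∘ suc)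

∑-𝟙 : ∀ {n} (i : Fin n) → ∑[ j < n ] 𝟙 (i ≟ j) ≡ 1
∑-𝟙 i = trans (sum-cong-≗ (λ j → sym (*-identityʳ (𝟙 (i ≟ j))))) (∑-𝟙-≟ i (λ _ → 1))

𝟙-≟-sym : ∀ {n} (i j : Fin n) → 𝟙 (i ≟ j) ≡ 𝟙 (j ≟ i)
𝟙-≟-sym i j = 𝟙-⇔ (i ≟ j) (j ≟ i) sym sym

length-filter-tabulate : ∀ {A : Set} {P : Pred A 0ℓ} (P? : Decidable P) {n} (f : Fin n → A) →
                         length (filter P? (tabulate f)) ≡ ∑[ i < n ] 𝟙 (P? (f i))
length-filter-tabulate P? {zero}  f = refl
length-filter-tabulate P? {suc n} f
  with does (P? (f zero)) | length-filter-tabulate P? (f ∘ suc)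
... | false | ih = ih
... | true  | ih = cong suc ih

-- Blocks: Fin (k₁ + ⋯ + kₘ) as a disjoint union of the Fin kᵢ

total : ∀ {m} → (Fin m → ℕ) → ℕ
total = sum +-0-commutativeMonoid

toΣ : ∀ {m} (k : Fin m → ℕ) → Fin (total k) → Σ[ i ∈ Fin m ] Fin (k i)
toΣ {suc m} k x =
  [ (zero ,_) , (λ y → map suc id (toΣ (k ∘ suc) y)) ]′ (splitAt (k zero) x)

fromΣ : ∀ {m} (k : Fin m → ℕ) (i : Fin m) → Fin (k i) → Fin (total k)
fromΣ k zero    a = a ↑ˡ total (k ∘ suc)
fromΣ k (suc i) a = k zero ↑ʳ fromΣ (k ∘ suc) i a

toΣ-fromΣ : ∀ {m} (k : Fin m → ℕ) i a → toΣ k (fromΣ k i a) ≡ (i , a)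
toΣ-fromΣ k zero    a rewrite splitAt-↑ˡ (k zero) a (total (k ∘ suc)) = refl
toΣ-fromΣ k (suc i) a
  rewrite splitAt-↑ʳ (k zero) (total (k ∘ suc)) (fromΣ (k ∘ suc) i a)
        | toΣ-fromΣ (k ∘ suc) i a = refl

-- That `toΣ` is a bijection enters the counting arguments in this form: a sum over all vertices
-- splits into sums over the blocks.
∑-toΣ : ∀ {m} (k : Fin m → ℕ) (F : Σ[ i ∈ Fin m ] Fin (k i) → ℕ) →
        ∑[ x < total k ] F (toΣ k x) ≡ ∑[ i < m ] ∑[ a < k i ] F (i , a)
∑-toΣ {zero}  k F = refl
∑-toΣ {suc m} k F = begin
  ∑[ x < k₀ + t ] F (toΣ k x)
    ≡⟨ ∑-↑ k₀ (F ∘ toΣ k) ⟩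
  ∑[ a < k₀ ] F (toΣ k (a ↑ˡ t)) + ∑[ y < t ] F (toΣ k (k₀ ↑ʳ y))
    ≡⟨ cong₂ _+_
         (sum-cong-≗ λ a → cong (F ∘ [ _ , _ ]′) (splitAt-↑ˡ k₀ a t))
         (sum-cong-≗ λ y → cong (F ∘ [ _ , _ ]′) (splitAt-↑ʳ k₀ t y)) ⟩
  ∑[ a < k₀ ] F (zero , a) + ∑[ y < t ] F (map suc id (toΣ (k ∘ suc) y))
    ≡⟨ cong (∑[ a < k₀ ] F (zero , a) +_) (∑-toΣ (k ∘ suc) (F ∘ map suc id)) ⟩
  ∑[ a < k₀ ] F (zero , a) + ∑[ i < m ] ∑[ a < k (suc i) ] F (suc i , a)
    ∎
  where
  k₀ = k zero
  t  = total (k ∘ suc)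

-- Edge counts

edgesInto-∑ : ∀ {n} (G : Digraph n) {P : Pred (Fin n) 0ℓ} (P? : Decidable P) u →
              edgesInto G P? u ≡
              ∑[ e < edgeCount G ] (𝟙 (P? (source G e)) * 𝟙 (target G e ≟ u))
edgesInto-∑ G P? u = trans
  (length-filter-tabulate (λ e → P? (source G e) ×-dec (target G e ≟ u)) id)
  (sum-cong-≗ λ e → 𝟙-× (P? (source G e)) (target G e ≟ u))

-- Each edge has exactly one source, so sorting the edges by source and exchanging the two sums
-- loses nothing. Every edge count is thereby expressed through the adjacency matrix.
edgesInto-adjacency : ∀ {n} (G : Digraph n) {P : Pred (Fin n) 0ℓ} (P? : Decidable P) u →
                      edgesInto G P? u ≡ ∑[ v < n ] (𝟙 (P? v) * adjacency G u v)
edgesInto-adjacency {n} G P? u = sym (begin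
  ∑[ v < n ] (𝟙 (P? v) * adjacency G u v)
    ≡⟨ sum-cong-≗ (λ v → cong (𝟙 (P? v) *_) (edgesInto-∑ G (_≟ v) u)) ⟩
  ∑[ v < n ] (𝟙 (P? v) * ∑[ e < E ] (𝟙 (s e ≟ v) * 𝟙 (t e ≟ u)))
    ≡⟨ sum-cong-≗ (λ v → *-distribˡ-sum (𝟙 (P? v)) (λ e → 𝟙 (s e ≟ v) * 𝟙 (t e ≟ u))) ⟩
  ∑[ v < n ] ∑[ e < E ] (𝟙 (P? v) * (𝟙 (s e ≟ v) * 𝟙 (t e ≟ u)))
    ≡⟨ ∑-comm (λ v e → 𝟙 (P? v) * (𝟙 (s e ≟ v) * 𝟙 (t e ≟ u))) ⟩
  ∑[ e < E ] ∑[ v < n ] (𝟙 (P? v) * (𝟙 (s e ≟ v) * 𝟙 (t e ≟ u)))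
    ≡⟨ sum-cong-≗ (λ e → sum-cong-≗ λ v → x*[y*z]≡y*[x*z] (𝟙 (P? v)) (𝟙 (s e ≟ v)) (𝟙 (t e ≟ u))) ⟩
  ∑[ e < E ] ∑[ v < n ] (𝟙 (s e ≟ v) * (𝟙 (P? v) * 𝟙 (t e ≟ u)))
    ≡⟨ sum-cong-≗ (λ e → ∑-𝟙-≟ (s e) (λ v → 𝟙 (P? v) * 𝟙 (t e ≟ u))) ⟩
  ∑[ e < E ] (𝟙 (P? (s e)) * 𝟙 (t e ≟ u))
    ≡⟨ edgesInto-∑ G P? u ⟨
  edgesInto G P? u
    ∎)
  where
  E = edgeCount G
  s = source G
  t = target G

-- Digraphs with a prescribed adjacency matrix

module _ {n : ℕ} (M : Fin n → Fin n → ℕ) where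

  private
    rowTotal : Fin n → ℕ
    rowTotal u = total (M u)

    -- An edge is decoded as a triple: its target `u`, its source `v`, and its index among the
    -- `M u v` parallel edges from `v` to `u`.
    edge : Fin (total rowTotal) → Σ[ u ∈ Fin n ] Σ[ v ∈ Fin n ] Fin (M u v)
    edge e = map id (λ {u} → toΣ (M u)) (toΣ rowTotal e)

  fromMatrix : Digraph n
  fromMatrix = record
    { edgeCount = total rowTotal
    ; source    = proj₁ ∘ proj₂ ∘ edge
    ; target    = proj₁ ∘ edge
    }

  adjacency-fromMatrix : ∀ u v → adjacency fromMatrix u v ≡ M u v
  adjacency-fromMatrix u v = begin
    adjacency fromMatrix u v
      ≡⟨ edgesInto-∑ fromMatrix (_≟ v) u ⟩
    ∑[ e < total rowTotal ] F (proj₁ (edge e)) (proj₁ (proj₂ (edge e)))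
      ≡⟨ ∑-toΣ rowTotal (λ (u′ , a) → F u′ (proj₁ (toΣ (M u′) a))) ⟩
    ∑[ u′ < n ] ∑[ a < rowTotal u′ ] F u′ (proj₁ (toΣ (M u′) a))
      ≡⟨ sum-cong-≗ (λ u′ → ∑-toΣ (M u′) (F u′ ∘ proj₁)) ⟩
    ∑[ u′ < n ] ∑[ v′ < n ] ∑[ c < M u′ v′ ] F u′ v′
      ≡⟨ sum-cong-≗ (λ u′ → sum-cong-≗ (pull u′)) ⟩
    ∑[ u′ < n ] ∑[ v′ < n ] (𝟙 (v ≟ v′) * (𝟙 (u ≟ u′) * M u′ v′))
      ≡⟨ sum-cong-≗ (λ u′ → ∑-𝟙-≟ v (λ v′ → 𝟙 (u ≟ u′) * M u′ v′)) ⟩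
    ∑[ u′ < n ] (𝟙 (u ≟ u′) * M u′ v)
      ≡⟨ ∑-𝟙-≟ u (λ u′ → M u′ v) ⟩
    M u v
      ∎
    where
    F : Fin n → Fin n → ℕ
    F u′ v′ = 𝟙 (v′ ≟ v) * 𝟙 (u′ ≟ u)

    pull : ∀ u′ v′ → ∑[ c < M u′ v′ ] F u′ v′ ≡ 𝟙 (v ≟ v′) * (𝟙 (u ≟ u′) * M u′ v′)
    pull u′ v′ = begin
      ∑[ c < M u′ v′ ] F u′ v′
        ≡⟨ sum-cong-≗ {M u′ v′} (λ _ → *-identityʳ (F u′ v′)) ⟨
      ∑[ c < M u′ v′ ] (F u′ v′ * 1)
        ≡⟨ *-distribˡ-sum {M u′ v′} (F u′ v′) (λ _ → 1) ⟨
      F u′ v′ * ∑[ c < M u′ v′ ] 1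
        ≡⟨ cong₂ _*_ (cong₂ _*_ (𝟙-≟-sym v′ v) (𝟙-≟-sym u′ u)) (∑-1 (M u′ v′)) ⟩
      𝟙 (v ≟ v′) * 𝟙 (u ≟ u′) * M u′ v′
        ≡⟨ *-assoc (𝟙 (v ≟ v′)) _ _ ⟩
      𝟙 (v ≟ v′) * (𝟙 (u ≟ u′) * M u′ v′)
        ∎

-- Residues

toℕ-mod : ∀ m n .{{_ : NonZero n}} → toℕ (m mod n) ≡ m % n
toℕ-mod m n = toℕ-fromℕ< (m%n<n m n)

toℕ-mod-id : ∀ {n} .{{_ : NonZero n}} (x : Fin n) → toℕ x mod n ≡ x
toℕ-mod-id {n} x = toℕ-injective (trans (toℕ-mod (toℕ x) n) (m<n⇒m%n≡m (toℕ<n x)))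

[n+m]mod-n : ∀ m n .{{_ : NonZero n}} → (n + m) mod n ≡ m mod n
[n+m]mod-n m n = toℕ-injective (begin
  toℕ ((n + m) mod n)  ≡⟨ toℕ-mod (n + m) n ⟩
  (n + m) % n          ≡⟨ cong (_% n) (+-comm n m) ⟩
  (m + n) % n          ≡⟨ [m+n]%n≡m%n m n ⟩
  m % n                ≡⟨ toℕ-mod m n ⟨
  toℕ (m mod n)        ∎)

-- The range splits into `q` consecutive blocks of length `k`, and each block meets the residue `a`
-- exactly once.
∑-residue : ∀ q k .{{_ : NonZero k}} (a : Fin k) →
            ∑[ e < q * k ] 𝟙 (toℕ e mod k ≟ a) ≡ q
∑-residue zero    k a = refl
∑-residue (suc q) k a = begin
  ∑[ e < k + q * k ] 𝟙 (toℕ e mod k ≟ a)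
    ≡⟨ ∑-↑ k (λ e → 𝟙 (toℕ e mod k ≟ a)) ⟩
  ∑[ x < k ] 𝟙 (toℕ (x ↑ˡ q * k) mod k ≟ a) + ∑[ y < q * k ] 𝟙 (toℕ (k ↑ʳ y) mod k ≟ a)
    ≡⟨ cong₂ _+_ (sum-cong-≗ first) (sum-cong-≗ {q * k} later) ⟩
  ∑[ x < k ] 𝟙 (a ≟ x) + ∑[ y < q * k ] 𝟙 (toℕ y mod k ≟ a)
    ≡⟨ cong₂ _+_ (∑-𝟙 a) (∑-residue q k a) ⟩
  suc q
    ∎
  where
  first : ∀ x → 𝟙 (toℕ (x ↑ˡ q * k) mod k ≟ a) ≡ 𝟙 (a ≟ x)
  first x = trans
    (cong (λ r → 𝟙 (r ≟ a)) (trans (cong (_mod k) (toℕ-↑ˡ x (q * k))) (toℕ-mod-id x)))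
    (𝟙-≟-sym x a)

  later : ∀ y → 𝟙 (toℕ (k ↑ʳ y) mod k ≟ a) ≡ 𝟙 (toℕ y mod k ≟ a)
  later y = cong (λ r → 𝟙 (r ≟ a))
    (trans (cong (_mod k) (toℕ-↑ʳ k y)) ([n+m]mod-n (toℕ y) k))

-- Class sizes of a symmetric graph

module _ {m n} {Q : Digraph m} {G : Digraph n} (symG : Symmetric G) (Q/G : Q IsQuotientOf G) where

  open _IsQuotientOf_ Q/G
  private
    module L = Bijection labelling
    module ⋈ = IsDecEquivalence isDecEq

  classSize : Fin m → ℕ
  classSize i = ∑[ v < n ] 𝟙 (L.to v ≟ i)

  classSize-positive : ∀ i → 0 < classSize i
  classSize-positive i with v , to-v ← L.surjective i = ≤-trans
    (≤-reflexive (sym (𝟙-true (L.to v ≟ i) (to-v ⋈.refl))))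
    (term≤∑ (λ v → 𝟙 (L.to v ≟ i)) v)

  total-classSize : total classSize ≡ n
  total-classSize = begin
    ∑[ i < m ] ∑[ v < n ] 𝟙 (L.to v ≟ i)  ≡⟨ ∑-comm (λ i v → 𝟙 (L.to v ≟ i)) ⟩
    ∑[ v < n ] ∑[ i < m ] 𝟙 (L.to v ≟ i)  ≡⟨ sum-cong-≗ (λ v → ∑-𝟙 (L.to v)) ⟩
    ∑[ v < n ] 1                          ≡⟨ ∑-1 n ⟩
    n                                     ∎

  adjacency-quotient : ∀ u j →
    adjacency Q (L.to u) j ≡ ∑[ v < n ] (𝟙 (L.to v ≟ j) * adjacency G u v)
  adjacency-quotient u j = begin
    adjacency Q (L.to u) j                     ≡⟨ adjacency≡ (L.to u) j ⟩
    edgesInto G (λ v → L.to v ≟ j) r           ≡⟨ byClass r ⟩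
    -- The representative `r` and the vertex `u` carry the same label, hence are equivalent, and
    -- balance moves the count from one to the other.
    edgesInto G (⋈._≟ w) r                     ≡⟨ balanced (L.injective (to-r ⋈.refl)) w ⟩
    edgesInto G (⋈._≟ w) u                     ≡⟨ byClass u ⟨
    edgesInto G (λ v → L.to v ≟ j) u           ≡⟨ edgesInto-adjacency G (λ v → L.to v ≟ j) u ⟩
    ∑[ v < n ] (𝟙 (L.to v ≟ j) * adjacency G u v) ∎
    where
    r    = proj₁ (L.surjective (L.to u))
    to-r = proj₂ (L.surjective (L.to u))
    w    = proj₁ (L.surjective j)
    to-w = proj₂ (L.surjective j)

    -- Bridges the two descriptions of a class: `quotientMatrix` selects it by its label `j`,
    -- `Balanced` by a member `w`.
    byClass : ∀ x → edgesInto G (λ v → L.to v ≟ j) x ≡ edgesInto G (⋈._≟ w) x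
    byClass x = begin
      edgesInto G (λ v → L.to v ≟ j) x
        ≡⟨ edgesInto-adjacency G (λ v → L.to v ≟ j) x ⟩
      ∑[ v < n ] (𝟙 (L.to v ≟ j) * adjacency G x v)
        ≡⟨ sum-cong-≗ (λ v → cong (_* adjacency G x v) (𝟙-⇔ (L.to v ≟ j) (v ⋈.≟ w)
             (λ to-v → L.injective (trans to-v (sym (to-w ⋈.refl)))) to-w)) ⟩
      ∑[ v < n ] (𝟙 (v ⋈.≟ w) * adjacency G x v)
        ≡⟨ edgesInto-adjacency G (⋈._≟ w) x ⟨
      edgesInto G (⋈._≟ w) x
        ∎

  -- The edges from the class labelled `j` into the class labelled `i`, in keeping with the row and
  -- column convention of `adjacency`.
  edgesBetween : Fin m → Fin m → ℕ
  edgesBetween i j =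
    ∑[ u < n ] ∑[ v < n ] (𝟙 (L.to u ≟ i) * (𝟙 (L.to v ≟ j) * adjacency G u v))

  edgesBetween-classSize : ∀ i j → classSize i * adjacency Q i j ≡ edgesBetween i j
  edgesBetween-classSize i j = begin
    classSize i * adjacency Q i j
      ≡⟨ *-distribʳ-sum (adjacency Q i j) (λ u → 𝟙 (L.to u ≟ i)) ⟩
    ∑[ u < n ] (𝟙 (L.to u ≟ i) * adjacency Q i j)
      -- The indicator allows `L.to u ≡ i` to be assumed, so row `i` of `Q` can be read off at each
      -- vertex `u` of its class.
      ≡⟨ sum-cong-≗ (λ u → 𝟙-*-cong (L.to u ≟ i) λ { refl → adjacency-quotient u j }) ⟩
    ∑[ u < n ] (𝟙 (L.to u ≟ i) * ∑[ v < n ] (𝟙 (L.to v ≟ j) * adjacency G u v))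
      ≡⟨ sum-cong-≗ (λ u → *-distribˡ-sum (𝟙 (L.to u ≟ i)) (λ v → 𝟙 (L.to v ≟ j) * adjacency G u v)) ⟩
    edgesBetween i j
      ∎

  edgesBetween-sym : ∀ i j → edgesBetween i j ≡ edgesBetween j i
  edgesBetween-sym i j = trans
    (∑-comm (λ u v → 𝟙 (L.to u ≟ i) * (𝟙 (L.to v ≟ j) * adjacency G u v)))
    (sum-cong-≗ λ v → sum-cong-≗ λ u → trans
      (x*[y*z]≡y*[x*z] (𝟙 (L.to u ≟ i)) (𝟙 (L.to v ≟ j)) (adjacency G u v))
      (cong (λ a → 𝟙 (L.to v ≟ j) * (𝟙 (L.to u ≟ i) * a)) (symG u v)))

  classSize-balance : ∀ i j → classSize i * adjacency Q i j ≡ classSize j * adjacency Q j i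
  classSize-balance i j = begin
    classSize i * adjacency Q i j  ≡⟨ edgesBetween-classSize i j ⟩
    edgesBetween i j               ≡⟨ edgesBetween-sym i j ⟩
    edgesBetween j i               ≡⟨ edgesBetween-classSize j i ⟨
    classSize j * adjacency Q j i  ∎

-- The symmetric graph with prescribed class sizes

module _ {m} (Q : Digraph m) (k : Fin m → ℕ) (k>0 : ∀ i → 0 < k i)
         (kq-sym : ∀ i j → k i * adjacency Q i j ≡ k j * adjacency Q j i) where

  private
    instance
      k≢0 : ∀ {i} → NonZero (k i)
      k≢0 {i} = >-nonZero (k>0 i)

    n = total k
    q = adjacency Q

    class : Fin n → Fin m
    class v = proj₁ (toΣ k v)

    position : (v : Fin n) → Fin (k (class v))
    position v = proj₂ (toΣ k v)

  -- Counts the `e` with residue `a` modulo `k i` and residue `b` modulo `k j`. For `i ≡ j` this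
  -- forces `a ≡ b`, so inside a class it gives `q i i` loops at each vertex.
  multiplicity : Σ[ i ∈ Fin m ] Fin (k i) → Σ[ i ∈ Fin m ] Fin (k i) → ℕ
  multiplicity (i , a) (j , b) =
    ∑[ e < k i * q i j ] (𝟙 (toℕ e mod k i ≟ a) * 𝟙 (toℕ e mod k j ≟ b))

  multiplicity-sym : ∀ x y → multiplicity x y ≡ multiplicity y x
  multiplicity-sym (i , a) (j , b) = ∑-toℕ-cong (kq-sym i j)
    (λ e → *-comm (𝟙 (e mod k i ≟ a)) (𝟙 (e mod k j ≟ b)))

  -- Every `e` has exactly one residue modulo `k j`, so summing over `b` removes the second
  -- condition; what remains counts the `e` with residue `a` modulo `k i`.
  ∑-multiplicity : ∀ i a j → ∑[ b < k j ] multiplicity (i , a) (j , b) ≡ q i j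
  ∑-multiplicity i a j = begin
    ∑[ b < k j ] ∑[ e < E ] (A (toℕ e) * 𝟙 (toℕ e mod k j ≟ b))
      ≡⟨ ∑-comm (λ b (e : Fin E) → A (toℕ e) * 𝟙 (toℕ e mod k j ≟ b)) ⟩
    ∑[ e < E ] ∑[ b < k j ] (A (toℕ e) * 𝟙 (toℕ e mod k j ≟ b))
      ≡⟨ sum-cong-≗ {E} (λ e → *-distribˡ-sum (A (toℕ e)) (λ b → 𝟙 (toℕ e mod k j ≟ b))) ⟨
    ∑[ e < E ] (A (toℕ e) * ∑[ b < k j ] 𝟙 (toℕ e mod k j ≟ b))
      ≡⟨ sum-cong-≗ {E} (λ e → trans (cong (A (toℕ e) *_) (∑-𝟙 (toℕ e mod k j))) (*-identityʳ _)) ⟩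
    ∑[ e < E ] A (toℕ e)
      -- The factors are swapped to present the range as `q i j` blocks of length `k i`.
      ≡⟨ ∑-toℕ-cong {f = A} (*-comm (k i) (q i j)) (λ _ → refl) ⟩
    ∑[ e < q i j * k i ] A (toℕ e)
      ≡⟨ ∑-residue (q i j) (k i) a ⟩
    q i j
      ∎
    where
    E = k i * q i j

    A : ℕ → ℕ
    A e = 𝟙 (e mod k i ≟ a)

  lift : Digraph n
  lift = fromMatrix (λ u v → multiplicity (toΣ k u) (toΣ k v))

  lift-symmetric : Symmetric lift
  lift-symmetric u v = begin
    adjacency lift u v                  ≡⟨ adjacency-fromMatrix _ u v ⟩
    multiplicity (toΣ k u) (toΣ k v)    ≡⟨ multiplicity-sym (toΣ k u) (toΣ k v) ⟩
    multiplicity (toΣ k v) (toΣ k u)    ≡⟨ adjacency-fromMatrix _ v u ⟨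
    adjacency lift v u                  ∎

  -- The count depends on `u` only through its class, which yields both balance and the quotient
  -- matrix.
  edgesInto-lift : ∀ u j → edgesInto lift (λ v → class v ≟ j) u ≡ q (class u) j
  edgesInto-lift u j = begin
    edgesInto lift (λ v → class v ≟ j) u
      ≡⟨ edgesInto-adjacency lift (λ v → class v ≟ j) u ⟩
    ∑[ v < n ] (𝟙 (class v ≟ j) * adjacency lift u v)
      ≡⟨ sum-cong-≗ (λ v → cong₂ _*_ (𝟙-≟-sym (class v) j) (adjacency-fromMatrix _ u v)) ⟩
    ∑[ v < n ] (𝟙 (j ≟ class v) * multiplicity x (toΣ k v))
      ≡⟨ ∑-toΣ k (λ y → 𝟙 (j ≟ proj₁ y) * multiplicity x y) ⟩
    ∑[ i < m ] ∑[ b < k i ] (𝟙 (j ≟ i) * multiplicity x (i , b))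
      ≡⟨ sum-cong-≗ (λ i → *-distribˡ-sum (𝟙 (j ≟ i)) (λ b → multiplicity x (i , b))) ⟨
    ∑[ i < m ] (𝟙 (j ≟ i) * ∑[ b < k i ] multiplicity x (i , b))
      ≡⟨ ∑-𝟙-≟ j (λ i → ∑[ b < k i ] multiplicity x (i , b)) ⟩
    ∑[ b < k j ] multiplicity x (j , b)
      ≡⟨ ∑-multiplicity (class u) (position u) j ⟩
    q (class u) j
      ∎
    where x = toΣ k u

  sameClass : IsDecEquivalence (λ u v → class u ≡ class v)
  sameClass = On.isDecEquivalence class (isDecEquivalence _≟_)

  class-surjective : ∀ i → Σ[ v ∈ Fin n ] class v ≡ i
  -- Position 0 exists in every block because `k i` is positive.
  class-surjective i = fromΣ k i (0 mod k i) , cong proj₁ (toΣ-fromΣ k i (0 mod k i))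

  classLabelling : Labelling sameClass m
  classLabelling = record
    { to        = class
    ; cong      = id
    ; bijective = id , λ i → map id (λ class-v eq → trans eq class-v) (class-surjective i)
    }

  lift-quotient : Q IsQuotientOf lift
  lift-quotient = record
    { _⋈_        = λ u v → class u ≡ class v
    ; isDecEq    = sameClass
    ; balanced   = λ {u} {v} u⋈v w → begin
        edgesInto lift (λ x → class x ≟ class w) u  ≡⟨ edgesInto-lift u (class w) ⟩
        q (class u) (class w)                       ≡⟨ cong (λ i → q i (class w)) u⋈v ⟩
        q (class v) (class w)                       ≡⟨ edgesInto-lift v (class w) ⟨
        edgesInto lift (λ x → class x ≟ class w) v  ∎
    ; labelling  = classLabelling
    ; adjacency≡ = λ i j → let r , class-r = class-surjective i in sym
        (trans (edgesInto-lift r j) (cong (λ i → q i j) class-r))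
    }

theorem2p1 : (m n : ℕ) → 0 < m → m < n → (Q : Digraph m) →
    (Σ[ G ∈ Digraph n ] (Symmetric G × Q IsQuotientOf G))
    ⇔
    (Σ[ k ∈ (Fin m → ℕ) ]
    ((∀ i → 0 < k i) ×
    sum +-0-commutativeMonoid k ≡ n ×
    (∀ i j → k i * adjacency Q i j ≡ k j * adjacency Q j i)))
theorem2p1 m n 0<m m<n Q = mk⇔
  (λ (G , symG , Q/G) →
    classSize symG Q/G ,
    classSize-positive symG Q/G ,
    total-classSize symG Q/G ,
    classSize-balance symG Q/G)
  -- Matching on `refl` replaces `n` by `total k`, the vertex count of `lift`.
  λ { (k , k>0 , refl , kq-sym) →
    lift Q k k>0 kq-sym ,
    lift-symmetric Q k k>0 kq-sym ,
    lift-quotient Q k k>0 kq-sym }
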